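{- The class of balanced matroids is not closed under taking $2$-sums.
   Context: For a matroid $\mathcal{M}$ on a finite set $E$ and disjoint $I,J\subseteq E$, let $M_I^J$ denote the number of bases $B$ of $\mathcal{M}$ with $I\subseteq B$ and $B\cap J=\varnothing$. $\mathcal{M}$ is negatively correlated if $M_e^fM_f^e-M_{ef}M^{ef}\ge0$ for all distinct $e,f\in E$, and balanced if every minor of $\mathcal{M}$ is negatively correlated. For matroids $\mathcal{M},\mathcal{Q}$ with $E(\mathcal{M})\cap E(\mathcal{Q})=\{g\}$, the $2$-sum $\mathcal{M}\oplus_g\mathcal{Q}$ is the matroid on $(E(\mathcal{M})\cup E(\mathcal{Q}))\setminus\{g\}$ whose bases are the sets $B_1\cup B_2$ where either $B_1\cup\{g\}$ is a basis of $\mathcal{M}$ (with $g\notin B_1$) and $B_2$ is a basis of $\mathcal{Q}$ not containing $g$, or $B_1$ is a basis of $\mathcal{M}$ not containing $g$ and $B_2\cup\{g\}$ is a basis of $\mathcal{Q}$ (with $g\notin B_2$). -}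

module Defs where

open import Data.Bool using (Bool; true; false; _∧_; _∨_; not; if_then_else_)
open import Data.Nat using (ℕ; zero; suc; _+_; _*_; _≤_)
open import Data.Fin using (Fin)
open import Data.Fin.Subset using (Subset; _∈_; _∉_; _-_; _∪_; ⁅_⁆)
open import Data.Vec using (Vec; []; _∷_; lookup; insertAt; take; drop)
open import Data.List using (List; []; _∷_; map; _++_; length; filter)
open import Data.Bool.ListAction using (any)
open import Data.Product using (Σ; ∃; _×_; _,_)
open import Relation.Binary.PropositionalEquality using (_≡_; _≢_)
open import Relation.Nullary using (¬_)
open import Relation.Nullary.Decidable using (does)
open import Data.Bool.Properties using (_≟_)

Family : ℕ → Set
Family n = Subset n → Bool

allSubsets : (n : ℕ) → List (Subset n)
allSubsets zero    = [] ∷ []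
allSubsets (suc n) = map (false ∷_) (allSubsets n) ++ map (true ∷_) (allSubsets n)

_⊆ᵇ_ : ∀ {n} → Subset n → Subset n → Bool
[]      ⊆ᵇ []      = true
(x ∷ xs) ⊆ᵇ (y ∷ ys) = (not x ∨ y) ∧ (xs ⊆ᵇ ys)

disjointᵇ : ∀ {n} → Subset n → Subset n → Bool
disjointᵇ []       []       = true
disjointᵇ (x ∷ xs) (y ∷ ys) = not (x ∧ y) ∧ disjointᵇ xs ys

count : ∀ {n} → Family n → Subset n → Subset n → ℕ
count {n} M I J =
  length (filter (λ B → (M B ∧ (I ⊆ᵇ B) ∧ disjointᵇ B J) ≟ true) (allSubsets n))

IsMatroid : ∀ {n} → Family n → Set
IsMatroid {n} M =
  (∃ λ (B : Subset n) → M B ≡ true) ×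
  (∀ (B₁ B₂ : Subset n) → M B₁ ≡ true → M B₂ ≡ true →
     ∀ x → x ∈ B₁ → x ∉ B₂ →
     ∃ λ y → y ∈ B₂ × y ∉ B₁ × M ((B₁ - x) ∪ ⁅ y ⁆) ≡ true)

∅ : ∀ {n} → Subset n
∅ {zero}  = []
∅ {suc n} = false ∷ ∅

NegativelyCorrelated : ∀ {n} → Family n → Set
NegativelyCorrelated {n} M =
  ∀ (e f : Fin n) → e ≢ f →
    count M (⁅ e ⁆ ∪ ⁅ f ⁆) ∅ * count M ∅ (⁅ e ⁆ ∪ ⁅ f ⁆)
      ≤ count M ⁅ e ⁆ ⁅ f ⁆ * count M ⁅ f ⁆ ⁅ e ⁆

-- Single-element deletion and contraction.  The ground set Fin n of the
-- minor is identified with Fin (suc n) minus e via insertAt.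

-- M \ e : if e is not a coloop, the bases avoiding e; otherwise B - e for bases B.
delete : ∀ {n} → Family (suc n) → Fin (suc n) → Family n
delete {n} M e B =
  if any (λ C → M C ∧ not (lookup C e)) (allSubsets (suc n))
  then M (insertAt B e false)
  else M (insertAt B e true)

-- M / e : if e is not a loop, B - e for bases B containing e; otherwise the bases.
contract : ∀ {n} → Family (suc n) → Fin (suc n) → Family n
contract {n} M e B =
  if any (λ C → M C ∧ lookup C e) (allSubsets (suc n))
  then M (insertAt B e true)
  else M (insertAt B e false)

data IsMinor {n : ℕ} (M : Family n) : {m : ℕ} → Family m → Set where
  self : IsMinor M M
  del  : ∀ {m} {N : Family (suc m)} → IsMinor M N → (e : Fin (suc m)) → IsMinor M (delete N e)
  con  : ∀ {m} {N : Family (suc m)} → IsMinor M N → (e : Fin (suc m)) → IsMinor M (contract N e)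

Balanced : ∀ {n} → Family n → Set
Balanced M = ∀ {m} (N : Family m) → IsMinor M N → NegativelyCorrelated N

-- 2-sum.  M lives on Fin (suc m) and Q on Fin (suc q); the common element g
-- is index 0 of both.  The 2-sum lives on Fin (m + q): the first m
-- elements are E(M) - g, the last q are E(Q) - g.

twoSum : ∀ {m q} → Family (suc m) → Family (suc q) → Family (m + q)
twoSum {m} {q} M Q B =
  (M (false ∷ B₁) ∧ Q (true ∷ B₂)) ∨ (M (true ∷ B₁) ∧ Q (false ∷ B₂))
  where
  B₁ = take m B
  B₂ = drop m B

{-# OPTIONS --safe #-}
module Submission where

-- Give g the weight y in the spike M below.  For its tip t and cotip c,
-- M_t^c M_c^t − M_tc M^tc = 8 − 8y, which vanishes at y = 1 but is negative at
-- y = 2.  With y = 1 every minor of M is negatively correlated.  The 2-sum with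
-- U₁,₃ replaces g by two parallel copies, i.e. sets y = 2.

open import Defs
open import Data.Bool using (Bool; true; false; _∧_; not)
open import Data.Bool.ListAction using (any)
open import Data.Bool.Properties using (_≟_; ∧-zeroʳ)
open import Data.Fin using (Fin; zero; suc; #_)
import Data.Fin.Properties as Fin
open import Data.Fin.Subset using (Subset; _∈_; _∉_; _-_; _∪_; ⁅_⁆; ⊥; ∣_∣)
open import Data.Fin.Subset.Properties using (_∈?_; ∪-identityˡ; ∪-identityʳ)
open import Data.List using (List; []; _∷_; _++_; length; filter; map)
open import Data.List.Properties using (filter-++; length-++)
open import Data.Nat using (ℕ; zero; suc; _+_; _*_; _≤_; _≤?_; _≡ᵇ_)
open import Data.Nat.Properties using (*-comm; +-identityʳ; +-commutativeSemigroup)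
open import Algebra.Properties.CommutativeSemigroup +-commutativeSemigroup using (interchange)
open import Data.Product using (Σ; ∃; _×_; _,_)
open import Data.Unit using (⊤; tt)
open import Data.Vec using ([]; _∷_; insertAt; lookup)
open import Function using (_∘_)
open import Relation.Binary.PropositionalEquality using (_≡_; _≢_; refl; sym; trans; cong; cong₂; subst)
open import Relation.Nullary using (¬_; Dec; yes; no; contradiction)
open import Relation.Nullary.Decidable using (_×-dec_; _→-dec_; ¬?; map′; from-yes; from-no)

-- Set families tabulated as binary trees

data Table : ℕ → Set where
  leaf : ℕ → Table zero
  node : ∀ {n} → Table n → Table n → Table (suc n)

infixl 6 _⊕_
-- Merging the two branches of a kept element creates multiplicities, hence leaves in `ℕ` rather
-- than `Bool`.
_⊕_ : ∀ {n} → Table n → Table n → Table n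
leaf a   ⊕ leaf b   = leaf (a + b)
node x y ⊕ node z w = node (x ⊕ z) (y ⊕ w)

restrict : ∀ {n} → Fin (suc n) → Bool → Table (suc n) → Table n
restrict         zero    false (node x y) = x
restrict         zero    true  (node x y) = y
restrict {suc n} (suc i) b     (node x y) = node (restrict i b x) (restrict i b y)

restrict-⊕ : ∀ {n} (i : Fin (suc n)) b (x y : Table (suc n)) →
             restrict i b (x ⊕ y) ≡ restrict i b x ⊕ restrict i b y
restrict-⊕         zero    false (node _ _) (node _ _) = refl
restrict-⊕         zero    true  (node _ _) (node _ _) = refl
restrict-⊕ {suc n} (suc i) b     (node x y) (node z w) =
  cong₂ node (restrict-⊕ i b x z) (restrict-⊕ i b y w)

indicator : Bool → ℕ
indicator false = 0
indicator true  = 1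

table : ∀ {n} → Family n → Table n
table {zero}  M = leaf (indicator (M []))
table {suc n} M = node (table (M ∘ (false ∷_))) (table (M ∘ (true ∷_)))

-- Both branches of `delete` and of `contract` have this `insertAt` form, so minors become
-- restrictions of tables.
table-restrict : ∀ {n} (M : Family (suc n)) i b →
                 table (λ B → M (insertAt B i b)) ≡ restrict i b (table M)
table-restrict         M zero    false = refl
table-restrict         M zero    true  = refl
table-restrict {suc n} M (suc i) b     =
  cong₂ node (table-restrict (M ∘ (false ∷_)) i b) (table-restrict (M ∘ (true ∷_)) i b)

tally : ∀ {n} → Table n → Subset n → Subset n → ℕ
tally (leaf a)   []          []          = a
tally (node x y) (false ∷ I) (false ∷ J) = tally x I J + tally y I J
tally (node x y) (false ∷ I) (true  ∷ J) = tally x I J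
tally (node x y) (true  ∷ I) (false ∷ J) = tally y I J
tally (node x y) (true  ∷ I) (true  ∷ J) = 0

-- Allows an element outside `I` and `J` to be summed out before the later elements are examined.
tally-⊕ : ∀ {n} (x y : Table n) I J → tally (x ⊕ y) I J ≡ tally x I J + tally y I J
tally-⊕ (leaf a)   (leaf b)   []          []          = refl
tally-⊕ (node x y) (node z w) (false ∷ I) (false ∷ J) =
  trans (cong₂ _+_ (tally-⊕ x z I J) (tally-⊕ y w I J))
        (interchange (tally x I J) (tally z I J) (tally y I J) (tally w I J))
tally-⊕ (node x y) (node z w) (false ∷ I) (true  ∷ J) = tally-⊕ x z I J
tally-⊕ (node x y) (node z w) (true  ∷ I) (false ∷ J) = tally-⊕ y w I J
tally-⊕ (node x y) (node z w) (true  ∷ I) (true  ∷ J) = refl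

-- Basis counts as tallies

countᵇ : ∀ {A : Set} → (A → Bool) → List A → ℕ
countᵇ p xs = length (filter (λ x → p x ≟ true) xs)

countᵇ-++ : ∀ {A : Set} (p : A → Bool) xs ys → countᵇ p (xs ++ ys) ≡ countᵇ p xs + countᵇ p ys
countᵇ-++ p xs ys =
  trans (cong length (filter-++ (λ x → p x ≟ true) xs ys)) (length-++ (filter (λ x → p x ≟ true) xs))

countᵇ-map : ∀ {A B : Set} (p : B → Bool) (f : A → B) xs → countᵇ p (map f xs) ≡ countᵇ (p ∘ f) xs
countᵇ-map p f []       = refl
countᵇ-map p f (x ∷ xs) with p (f x)
... | true  = cong suc (countᵇ-map p f xs)
... | false = countᵇ-map p f xs

countᵇ-none : ∀ {A : Set} (p : A → Bool) → (∀ x → p x ≡ false) → ∀ xs → countᵇ p xs ≡ 0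
countᵇ-none p none []       = refl
countᵇ-none p none (x ∷ xs) rewrite none x = countᵇ-none p none xs

member : ∀ {n} → Family n → Subset n → Subset n → Family n
member M I J B = M B ∧ (I ⊆ᵇ B) ∧ disjointᵇ B J

count-∷ : ∀ {n} (M : Family (suc n)) I J → count M I J ≡
  countᵇ (member M I J ∘ (false ∷_)) (allSubsets n) + countᵇ (member M I J ∘ (true ∷_)) (allSubsets n)
count-∷ {n} M I J =
  trans (countᵇ-++ (member M I J) (map (false ∷_) (allSubsets n)) (map (true ∷_) (allSubsets n)))
        (cong₂ _+_ (countᵇ-map (member M I J) (false ∷_) (allSubsets n))
                   (countᵇ-map (member M I J) (true ∷_) (allSubsets n)))

-- Induction on the first element: the half of the subsets that conflicts with `i` or `j`
-- contributes nothing.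
count≡tally : ∀ {n} (M : Family n) I J → count M I J ≡ tally (table M) I J
count≡tally {zero} M [] [] with M []
... | true  = refl
... | false = refl
count≡tally {suc n} M (i ∷ I) (j ∷ J) = trans (count-∷ M (i ∷ I) (j ∷ J)) (step i j)
  where
  absent : ∀ B → M (false ∷ B) ∧ false ≡ false
  absent B = ∧-zeroʳ _
  present : ∀ (b : Subset n → Bool) B → M (true ∷ B) ∧ b B ∧ false ≡ false
  present b B = trans (cong (M (true ∷ B) ∧_) (∧-zeroʳ (b B))) (∧-zeroʳ _)
  step : ∀ i j → countᵇ (member M (i ∷ I) (j ∷ J) ∘ (false ∷_)) (allSubsets n)
               + countᵇ (member M (i ∷ I) (j ∷ J) ∘ (true ∷_)) (allSubsets n)
               ≡ tally (table M) (i ∷ I) (j ∷ J)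
  step false false = cong₂ _+_ (count≡tally (M ∘ (false ∷_)) I J) (count≡tally (M ∘ (true ∷_)) I J)
  step false true  = trans (cong₂ _+_ (count≡tally (M ∘ (false ∷_)) I J) (countᵇ-none _ (present (I ⊆ᵇ_)) (allSubsets n)))
                           (+-identityʳ _)
  step true  false = cong₂ _+_ (countᵇ-none _ absent (allSubsets n)) (count≡tally (M ∘ (true ∷_)) I J)
  step true  true  = cong₂ _+_ (countᵇ-none _ absent (allSubsets n))
                                 (countᵇ-none _ (present (I ⊆ᵇ_)) (allSubsets n))

-- Neg₀ x says that every minor of the family tabulated by x is negatively
-- correlated.  The recursion decides the fate of one element at a time: deleted,
-- contracted, kept (⊕), or chosen as e or f.  In Neg₁ x y, e has been chosen: x
-- tabulates the sets with e and y those without.  In Neg₂ a b c d both have been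
-- chosen: a contains e and f, b only e, c only f, d neither.
Neg₂ : ∀ {n} (a b c d : Table n) → Set
Neg₂ (leaf a)     (leaf b)     (leaf c)     (leaf d)     = a * d ≤ b * c
Neg₂ (node a₀ a₁) (node b₀ b₁) (node c₀ c₁) (node d₀ d₁) =
  Neg₂ a₀ b₀ c₀ d₀ × Neg₂ a₁ b₁ c₁ d₁ × Neg₂ (a₀ ⊕ a₁) (b₀ ⊕ b₁) (c₀ ⊕ c₁) (d₀ ⊕ d₁)

Neg₁ : ∀ {n} (x y : Table n) → Set
Neg₁ (leaf _)     (leaf _)     = ⊤
Neg₁ (node x₀ x₁) (node y₀ y₁) =
  Neg₁ x₀ y₀ × Neg₁ x₁ y₁ × Neg₁ (x₀ ⊕ x₁) (y₀ ⊕ y₁) × Neg₂ x₁ x₀ y₁ y₀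

Neg₀ : ∀ {n} → Table n → Set
Neg₀ (leaf _)     = ⊤
Neg₀ (node x₀ x₁) = Neg₀ x₀ × Neg₀ x₁ × Neg₀ (x₀ ⊕ x₁) × Neg₁ x₁ x₀

Neg₂? : ∀ {n} (a b c d : Table n) → Dec (Neg₂ a b c d)
Neg₂? (leaf a)     (leaf b)     (leaf c)     (leaf d)     = a * d ≤? b * c
Neg₂? (node a₀ a₁) (node b₀ b₁) (node c₀ c₁) (node d₀ d₁) =
  Neg₂? a₀ b₀ c₀ d₀ ×-dec Neg₂? a₁ b₁ c₁ d₁ ×-dec Neg₂? (a₀ ⊕ a₁) (b₀ ⊕ b₁) (c₀ ⊕ c₁) (d₀ ⊕ d₁)

Neg₁? : ∀ {n} (x y : Table n) → Dec (Neg₁ x y)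
Neg₁? (leaf _)     (leaf _)     = yes tt
Neg₁? (node x₀ x₁) (node y₀ y₁) =
  Neg₁? x₀ y₀ ×-dec Neg₁? x₁ y₁ ×-dec Neg₁? (x₀ ⊕ x₁) (y₀ ⊕ y₁) ×-dec Neg₂? x₁ x₀ y₁ y₀

Neg₀? : ∀ {n} (x : Table n) → Dec (Neg₀ x)
Neg₀? (leaf _)     = yes tt
Neg₀? (node x₀ x₁) = Neg₀? x₀ ×-dec Neg₀? x₁ ×-dec Neg₀? (x₀ ⊕ x₁) ×-dec Neg₁? x₁ x₀

-- Closure under restriction

Neg₂-restrict : ∀ {n} i v (a b c d : Table (suc n)) → Neg₂ a b c d →
                Neg₂ (restrict i v a) (restrict i v b) (restrict i v c) (restrict i v d)
Neg₂-restrict zero false (node _ _) (node _ _) (node _ _) (node _ _) (p , _ , _) = p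
Neg₂-restrict zero true  (node _ _) (node _ _) (node _ _) (node _ _) (_ , q , _) = q
Neg₂-restrict {suc n} (suc i) v (node a₀ a₁) (node b₀ b₁) (node c₀ c₁) (node d₀ d₁) (p , q , r)
  -- `s` is bound before the rewrite, so that its restrictions are distributed over `⊕` as the goal
  -- requires.
  with s ← Neg₂-restrict i v (a₀ ⊕ a₁) (b₀ ⊕ b₁) (c₀ ⊕ c₁) (d₀ ⊕ d₁) r
  rewrite restrict-⊕ i v a₀ a₁ | restrict-⊕ i v b₀ b₁ | restrict-⊕ i v c₀ c₁ | restrict-⊕ i v d₀ d₁
  = Neg₂-restrict i v a₀ b₀ c₀ d₀ p , Neg₂-restrict i v a₁ b₁ c₁ d₁ q , s

Neg₁-restrict : ∀ {n} i v (x y : Table (suc n)) → Neg₁ x y → Neg₁ (restrict i v x) (restrict i v y)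
Neg₁-restrict zero false (node _ _) (node _ _) (p , _ , _) = p
Neg₁-restrict zero true  (node _ _) (node _ _) (_ , q , _) = q
Neg₁-restrict {suc n} (suc i) v (node x₀ x₁) (node y₀ y₁) (p , q , r , t)
  with s ← Neg₁-restrict i v (x₀ ⊕ x₁) (y₀ ⊕ y₁) r
  rewrite restrict-⊕ i v x₀ x₁ | restrict-⊕ i v y₀ y₁
  = Neg₁-restrict i v x₀ y₀ p , Neg₁-restrict i v x₁ y₁ q , s , Neg₂-restrict i v x₁ x₀ y₁ y₀ t

Neg₀-restrict : ∀ {n} i v (x : Table (suc n)) → Neg₀ x → Neg₀ (restrict i v x)
Neg₀-restrict zero false (node _ _) (p , _ , _) = p
Neg₀-restrict zero true  (node _ _) (_ , q , _) = q
Neg₀-restrict {suc n} (suc i) v (node x₀ x₁) (p , q , r , t)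
  with s ← Neg₀-restrict i v (x₀ ⊕ x₁) r
  rewrite restrict-⊕ i v x₀ x₁
  = Neg₀-restrict i v x₀ p , Neg₀-restrict i v x₁ q , s , Neg₁-restrict i v x₁ x₀ t

-- From the recursive conditions to negative correlation

⊥≡∅ : ∀ {n} → ⊥ {n} ≡ ∅
⊥≡∅ {zero}  = refl
⊥≡∅ {suc n} = cong (false ∷_) ⊥≡∅

-- Keeping every remaining element collapses each table to a single leaf, its total.
Neg₂⇒≤ : ∀ {n} (a b c d : Table n) → Neg₂ a b c d →
         tally a ∅ ∅ * tally d ∅ ∅ ≤ tally b ∅ ∅ * tally c ∅ ∅
Neg₂⇒≤ (leaf _) (leaf _) (leaf _) (leaf _) p = p
Neg₂⇒≤ {suc n} (node a₀ a₁) (node b₀ b₁) (node c₀ c₁) (node d₀ d₁) (_ , _ , r)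
  rewrite sym (tally-⊕ a₀ a₁ ∅ ∅) | sym (tally-⊕ b₀ b₁ ∅ ∅)
        | sym (tally-⊕ c₀ c₁ ∅ ∅) | sym (tally-⊕ d₀ d₁ ∅ ∅)
  = Neg₂⇒≤ (a₀ ⊕ a₁) (b₀ ⊕ b₁) (c₀ ⊕ c₁) (d₀ ⊕ d₁) r

Neg₁⇒≤ : ∀ {n} (x y : Table n) → Neg₁ x y → ∀ i →
         tally x ⁅ i ⁆ ∅ * tally y ∅ ⁅ i ⁆ ≤ tally x ∅ ⁅ i ⁆ * tally y ⁅ i ⁆ ∅
Neg₁⇒≤ {suc n} (node x₀ x₁) (node y₀ y₁) (_ , _ , _ , t) zero
  -- The tail of `⁅ zero ⁆` is `⊥`, whereas `Neg₂⇒≤` speaks of `∅`.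
  rewrite ⊥≡∅ {n} = Neg₂⇒≤ x₁ x₀ y₁ y₀ t
Neg₁⇒≤ (node x₀ x₁) (node y₀ y₁) (_ , _ , r , _) (suc i)
  rewrite sym (tally-⊕ x₀ x₁ ⁅ i ⁆ ∅) | sym (tally-⊕ y₀ y₁ ∅ ⁅ i ⁆)
        | sym (tally-⊕ x₀ x₁ ∅ ⁅ i ⁆) | sym (tally-⊕ y₀ y₁ ⁅ i ⁆ ∅)
  = Neg₁⇒≤ (x₀ ⊕ x₁) (y₀ ⊕ y₁) r i

Neg₀⇒≤ : ∀ {n} (x : Table n) → Neg₀ x → ∀ e f → e ≢ f →
         tally x (⁅ e ⁆ ∪ ⁅ f ⁆) ∅ * tally x ∅ (⁅ e ⁆ ∪ ⁅ f ⁆)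
           ≤ tally x ⁅ e ⁆ ⁅ f ⁆ * tally x ⁅ f ⁆ ⁅ e ⁆
Neg₀⇒≤ _ _ zero zero e≢f = contradiction refl e≢f
Neg₀⇒≤ {suc n} (node x₀ x₁) (_ , _ , _ , t) zero (suc f) _
  rewrite ∪-identityˡ ⁅ f ⁆ | ⊥≡∅ {n} = Neg₁⇒≤ x₁ x₀ t f
Neg₀⇒≤ {suc n} (node x₀ x₁) (_ , _ , _ , t) (suc e) zero _
  -- The inequality is symmetric in the two elements; the one of smaller index is always chosen
  -- first.
  rewrite ∪-identityʳ ⁅ e ⁆ | ⊥≡∅ {n} | *-comm (tally x₀ ⁅ e ⁆ ∅) (tally x₁ ∅ ⁅ e ⁆) = Neg₁⇒≤ x₁ x₀ t e
Neg₀⇒≤ (node x₀ x₁) (_ , _ , r , _) (suc e) (suc f) e≢f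
  rewrite sym (tally-⊕ x₀ x₁ (⁅ e ⁆ ∪ ⁅ f ⁆) ∅) | sym (tally-⊕ x₀ x₁ ∅ (⁅ e ⁆ ∪ ⁅ f ⁆))
        | sym (tally-⊕ x₀ x₁ ⁅ e ⁆ ⁅ f ⁆) | sym (tally-⊕ x₀ x₁ ⁅ f ⁆ ⁅ e ⁆)
  = Neg₀⇒≤ (x₀ ⊕ x₁) r e f (e≢f ∘ cong suc)

Neg₀⇒NegativelyCorrelated : ∀ {n} (M : Family n) → Neg₀ (table M) → NegativelyCorrelated M
Neg₀⇒NegativelyCorrelated M neg e f e≢f
  rewrite count≡tally M (⁅ e ⁆ ∪ ⁅ f ⁆) ∅ | count≡tally M ∅ (⁅ e ⁆ ∪ ⁅ f ⁆)
        | count≡tally M ⁅ e ⁆ ⁅ f ⁆ | count≡tally M ⁅ f ⁆ ⁅ e ⁆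
  = Neg₀⇒≤ (table M) neg e f e≢f

-- Minors and balance

Neg₀-insertAt : ∀ {n} (M : Family (suc n)) i b → Neg₀ (table M) → Neg₀ (table (λ B → M (insertAt B i b)))
Neg₀-insertAt M i b neg = subst Neg₀ (sym (table-restrict M i b)) (Neg₀-restrict i b (table M) neg)

Neg₀-delete : ∀ {n} (M : Family (suc n)) i → Neg₀ (table M) → Neg₀ (table (delete M i))
Neg₀-delete {n} M i neg with any (λ C → M C ∧ not (lookup C i)) (allSubsets (suc n))
... | true  = Neg₀-insertAt M i false neg
... | false = Neg₀-insertAt M i true neg

Neg₀-contract : ∀ {n} (M : Family (suc n)) i → Neg₀ (table M) → Neg₀ (table (contract M i))
Neg₀-contract {n} M i neg with any (λ C → M C ∧ lookup C i) (allSubsets (suc n))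
... | true  = Neg₀-insertAt M i true neg
... | false = Neg₀-insertAt M i false neg

Neg₀-minor : ∀ {n m} {M : Family n} {N : Family m} → IsMinor M N → Neg₀ (table M) → Neg₀ (table N)
Neg₀-minor self              neg = neg
Neg₀-minor (del {N = N} p e) neg = Neg₀-delete N e (Neg₀-minor p neg)
Neg₀-minor (con {N = N} p e) neg = Neg₀-contract N e (Neg₀-minor p neg)

-- Replaces the quantifier over all minors by one decidable condition on one table.
Neg₀⇒Balanced : ∀ {n} (M : Family n) → Neg₀ (table M) → Balanced M
Neg₀⇒Balanced M neg N minor = Neg₀⇒NegativelyCorrelated N (Neg₀-minor minor neg)

-- Deciding basis exchange

allSubset? : ∀ {n} {P : Subset n → Set} → (∀ B → Dec (P B)) → Dec (∀ B → P B)
allSubset? {zero}  P? = map′ (λ { p [] → p }) (λ p → p []) (P? [])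
allSubset? {suc n} P? =
  map′ (λ { (p , q) (false ∷ B) → p B ; (p , q) (true ∷ B) → q B })
       (λ p → p ∘ (false ∷_) , p ∘ (true ∷_))
       (allSubset? (P? ∘ (false ∷_)) ×-dec allSubset? (P? ∘ (true ∷_)))

Exchange : ∀ {n} → Family n → Set
Exchange {n} M = ∀ (B₁ B₂ : Subset n) → M B₁ ≡ true → M B₂ ≡ true →
  ∀ x → x ∈ B₁ → x ∉ B₂ → ∃ λ y → y ∈ B₂ × y ∉ B₁ × M ((B₁ - x) ∪ ⁅ y ⁆) ≡ true

-- `B₁` is tested for being a basis before `B₂` is enumerated, so nonbases cost no inner search.
Exchange? : ∀ {n} (M : Family n) → Dec (Exchange M)
Exchange? M = map′ (λ p B₁ B₂ b₁ b₂ → p B₁ b₁ B₂ b₂) (λ p B₁ b₁ B₂ b₂ → p B₁ B₂ b₁ b₂)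
  (allSubset? λ B₁ → M B₁ ≟ true →-dec allSubset? λ B₂ → M B₂ ≟ true →-dec
   Fin.all? λ x → x ∈? B₁ →-dec ¬? (x ∈? B₂) →-dec
   Fin.any? λ y → y ∈? B₂ ×-dec ¬? (y ∈? B₁) ×-dec M ((B₁ - x) ∪ ⁅ y ⁆) ≟ true)

-- The two matroids and their 2-sum

pattern ○ = false
pattern ● = true

-- A rank-4 spike with tip t and cotip c, in the order g g′ a a′ b b′ t c: the three
-- lines {t,g,g′}, {t,a,a′}, {t,b,b′} through t, the planes spanned by two of
-- them, and the two further planes {g,a,b′,c} and {g,a′,b,c}.  These are its
-- non-spanning circuits, and g has index 0.
spikeCircuits : List (Subset 8)
spikeCircuits =
    (● ∷ ● ∷ ○ ∷ ○ ∷ ○ ∷ ○ ∷ ● ∷ ○ ∷ [])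
  ∷ (○ ∷ ○ ∷ ● ∷ ● ∷ ○ ∷ ○ ∷ ● ∷ ○ ∷ [])
  ∷ (○ ∷ ○ ∷ ○ ∷ ○ ∷ ● ∷ ● ∷ ● ∷ ○ ∷ [])
  ∷ (● ∷ ● ∷ ● ∷ ● ∷ ○ ∷ ○ ∷ ○ ∷ ○ ∷ [])
  ∷ (● ∷ ● ∷ ○ ∷ ○ ∷ ● ∷ ● ∷ ○ ∷ ○ ∷ [])
  ∷ (○ ∷ ○ ∷ ● ∷ ● ∷ ● ∷ ● ∷ ○ ∷ ○ ∷ [])
  ∷ (● ∷ ○ ∷ ● ∷ ○ ∷ ○ ∷ ● ∷ ○ ∷ ● ∷ [])
  ∷ (● ∷ ○ ∷ ○ ∷ ● ∷ ● ∷ ○ ∷ ○ ∷ ● ∷ [])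
  ∷ []

spike : Family 8
spike B = (∣ B ∣ ≡ᵇ 4) ∧ not (any (_⊆ᵇ B) spikeCircuits)

-- One basis is index 0 alone and two avoid it, so in the 2-sum each basis of `spike` through g
-- counts twice and every other once.
U₁₃ : Family 3
U₁₃ B = ∣ B ∣ ≡ᵇ 1

spike-Exchange : Exchange spike
spike-Exchange = from-yes (Exchange? spike)

-- A finite evaluation. For t and c in `spike` itself the inequality is tight: 12 · 12 = 8 · 18.
spike-Neg₀ : Neg₀ (table spike)
spike-Neg₀ = from-yes (Neg₀? (table spike))

U₁₃-Exchange : Exchange U₁₃
U₁₃-Exchange = from-yes (Exchange? U₁₃)

U₁₃-Neg₀ : Neg₀ (table U₁₃)
U₁₃-Neg₀ = from-yes (Neg₀? (table U₁₃))

spike⊕U₁₃-Exchange : Exchange (twoSum spike U₁₃)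
spike⊕U₁₃-Exchange = from-yes (Exchange? (twoSum spike U₁₃))

spike⊕U₁₃-¬Balanced : ¬ Balanced (twoSum spike U₁₃)
spike⊕U₁₃-¬Balanced balanced =
  -- Here the products are 16 · 20 = 320 and 12 · 26 = 312.
  from-no (count M (⁅ t ⁆ ∪ ⁅ c ⁆) ∅ * count M ∅ (⁅ t ⁆ ∪ ⁅ c ⁆) ≤? count M ⁅ t ⁆ ⁅ c ⁆ * count M ⁅ c ⁆ ⁅ t ⁆)
    (balanced M self t c λ ())
  where
  M = twoSum spike U₁₃
  t c : Fin 9
  -- Removing g lowers the indices of t and c by one; 7 and 8 are the copies of g.
  t = # 5
  c = # 6

theorem5p11 : Σ ℕ λ m → Σ ℕ λ q → Σ (Family (suc m)) λ M → Σ (Family (suc q)) λ Q →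
    IsMatroid M × IsMatroid Q × Balanced M × Balanced Q ×
    IsMatroid (twoSum M Q) × ¬ Balanced (twoSum M Q)
theorem5p11 =
  7 , 2 , spike , U₁₃ ,
  -- The basis {g′, a′, b′, c}: both listed circuits through c contain g.
  ((○ ∷ ● ∷ ○ ∷ ● ∷ ○ ∷ ● ∷ ○ ∷ ● ∷ [] , refl) , spike-Exchange) ,
  ((● ∷ ○ ∷ ○ ∷ [] , refl) , U₁₃-Exchange) ,
  Neg₀⇒Balanced spike spike-Neg₀ ,
  Neg₀⇒Balanced U₁₃ U₁₃-Neg₀ ,
  -- The basis {g, a′, b′, c} of `spike`, with g replaced by its first copy.
  ((○ ∷ ○ ∷ ● ∷ ○ ∷ ● ∷ ○ ∷ ● ∷ ● ∷ ○ ∷ [] , refl) , spike⊕U₁₃-Exchange) ,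
  spike⊕U₁₃-¬Balanced
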